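{- Let $\Sigma_1$ and $\Sigma_2$ be signed simple graphs with chromatic numbers $\chi_1,\chi_2$ and maximum deficiencies $M_1,M_2$, respectively. Assume that $\chi_1$ and $\chi_2$ are even, $M_1 > M_2$, and $\chi_1 \leq \chi_1 + \chi_2 - M_1 - M_2 + 1$. If exactly one of $M_1$ and $M_2$ is odd, and both $\Sigma_1$ and $\Sigma_2$ are exceptional, then $\chi(\Sigma_1 \vee_+ \Sigma_2) = \chi_1 + \chi_2 - M_1 - M_2 + 1$.
   Context: A signed simple graph is $\Sigma=(V,E,\sigma)$ where $(V,E)$ is a graph with no loops and no multiple edges and $\sigma:E\to\{+,-\}$. A proper coloration of $\Sigma$ is a function $\kappa: V \to \{\pm1,\ldots,\pm k,0\}$ such that for every edge $e$ with endpoints $a,b$, $\kappa(a)\neq \sigma(e)\kappa(b)$. Color sets are $\{\pm1,\ldots,\pm k\}$ (size $2k$) or $\{\pm1,\ldots,\pm k,0\}$ (size $2k+1$). The chromatic number $\chi(\Sigma)$ is the smallest size of a color set with which $\Sigma$ can be properly colored. A coloration is minimal if it is proper and takes values in a color set of size $\chi(\Sigma)$. A coloration "uses $m$ colors" if its image has $m$ elements. The deficiency of a coloration is the number of colors of its color set not used by it; the maximum deficiency $\operatorname{M}(\Sigma)$ is the maximum deficiency over all minimal proper colorations of $\Sigma$. A signed graph $\Sigma$ with even chromatic number and maximum deficiency $M$ is exceptional if in every proper coloration using $\chi(\Sigma)-M$ colors, every color that is used appears at both endpoints of some negative edge. The all-positive join $\Sigma_1\vee_+\Sigma_2$ is the signed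 graph on the disjoint union $V(\Sigma_1)\cup V(\Sigma_2)$ whose edges are those of $\Sigma_1$ and $\Sigma_2$ (with their signs) together with a positive edge $vw$ for every $v\in V(\Sigma_1)$, $w\in V(\Sigma_2)$. -}

module Defs where

open import Data.Nat using (ℕ; zero; suc; _+_; _*_; _≤_; _%_)
open import Data.Integer as ℤ using (ℤ; ∣_∣; -_; 0ℤ)
open import Data.Fin using (Fin; splitAt)
open import Data.Sum using (_⊎_; inj₁; inj₂)
open import Data.Product using (_×_; Σ; ∃; ∃-syntax; _,_)
open import Data.List using (List; length; deduplicate; tabulate)
open import Relation.Binary.PropositionalEquality using (_≡_; _≢_)

-- Edge labels: no edge, positive edge, negative edge.
data Label : Set where
  none pos neg : Label

-- A finite signed simple graph on vertex set Fin n: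
-- symmetric labelling, no loops (a label per unordered pair = no multi-edges).
record SignedGraph : Set where
  field
    n     : ℕ
    edge  : Fin n → Fin n → Label
    symm  : ∀ a b → edge a b ≡ edge b a
    loopless : ∀ a → edge a a ≡ none
open SignedGraph public

Even Odd : ℕ → Set
Even m = m % 2 ≡ 0
Odd  m = m % 2 ≡ 1

-- The color set of size m: {±1..±k} if m = 2k, {±1..±k,0} if m = 2k+1.
InColorSet : ℕ → ℤ → Set
InColorSet m c = (c ≡ 0ℤ × Odd m) ⊎ (c ≢ 0ℤ × 2 * ∣ c ∣ ≤ m)

Coloration : SignedGraph → Set
Coloration Σg = Fin (n Σg) → ℤ

-- κ(a) ≠ σ(e) κ(b) for every edge e = ab
Proper : (Σg : SignedGraph) → Coloration Σg → Set
Proper Σg κ = ∀ a b → (edge Σg a b ≡ pos → κ a ≢ κ b)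
                    × (edge Σg a b ≡ neg → κ a ≢ - κ b)

-- κ takes values in the color set of size m
InSet : (Σg : SignedGraph) → ℕ → Coloration Σg → Set
InSet Σg m κ = ∀ v → InColorSet m (κ v)

-- number of colors used = size of the image of κ
colorsUsed : (Σg : SignedGraph) → Coloration Σg → ℕ
colorsUsed Σg κ = length (deduplicate ℤ._≟_ (tabulate κ))

Colorable : SignedGraph → ℕ → Set
Colorable Σg m = ∃[ κ ] (Proper Σg κ × InSet Σg m κ)

-- χ is the chromatic number of Σg
IsChromatic : SignedGraph → ℕ → Set
IsChromatic Σg χ = Colorable Σg χ × (∀ m → Colorable Σg m → χ ≤ m)

-- minimal coloration (with respect to the chromatic number χ)
Minimal : (Σg : SignedGraph) → ℕ → Coloration Σg → Set
Minimal Σg χ κ = Proper Σg κ × InSet Σg χ κ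

-- M is the maximum deficiency (χ − colorsUsed) over minimal colorations
IsMaxDeficiency : SignedGraph → ℕ → ℕ → Set
IsMaxDeficiency Σg χ M =
  (∃[ κ ] (Minimal Σg χ κ × colorsUsed Σg κ + M ≡ χ))
  × (∀ κ → Minimal Σg χ κ → χ ≤ colorsUsed Σg κ + M)

-- Σg (with chromatic number χ, even, and maximum deficiency M) is exceptional:
-- in every proper coloration using χ − M colors, every used color appears at
-- both endpoints of some negative edge.
Exceptional : SignedGraph → ℕ → ℕ → Set
Exceptional Σg χ M =
  IsChromatic Σg χ × Even χ × IsMaxDeficiency Σg χ M ×
  (∀ κ → Proper Σg κ → colorsUsed Σg κ + M ≡ χ →
     ∀ v → ∃[ a ] ∃[ b ] (edge Σg a b ≡ neg × κ a ≡ κ v × κ b ≡ κ v))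

-- all-positive join
joinLabel : (Σ₁ Σ₂ : SignedGraph) → Fin (n Σ₁ + n Σ₂) → Fin (n Σ₁ + n Σ₂) → Label
joinLabel Σ₁ Σ₂ a b with splitAt (n Σ₁) a | splitAt (n Σ₁) b
... | inj₁ i | inj₁ j = edge Σ₁ i j
... | inj₂ i | inj₂ j = edge Σ₂ i j
... | inj₁ _ | inj₂ _ = pos
... | inj₂ _ | inj₁ _ = pos

private
  jsymm : ∀ Σ₁ Σ₂ a b → joinLabel Σ₁ Σ₂ a b ≡ joinLabel Σ₁ Σ₂ b a
  jsymm Σ₁ Σ₂ a b with splitAt (n Σ₁) a | splitAt (n Σ₁) b
  ... | inj₁ i | inj₁ j = symm Σ₁ i j
  ... | inj₂ i | inj₂ j = symm Σ₂ i j
  ... | inj₁ _ | inj₂ _ = _≡_.refl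
  ... | inj₂ _ | inj₁ _ = _≡_.refl

  jloop : ∀ Σ₁ Σ₂ a → joinLabel Σ₁ Σ₂ a a ≡ none
  jloop Σ₁ Σ₂ a with splitAt (n Σ₁) a
  ... | inj₁ i = loopless Σ₁ i
  ... | inj₂ i = loopless Σ₂ i

_∨₊_ : SignedGraph → SignedGraph → SignedGraph
Σ₁ ∨₊ Σ₂ = record
  { n = n Σ₁ + n Σ₂
  ; edge = joinLabel Σ₁ Σ₂
  ; symm = jsymm Σ₁ Σ₂
  ; loopless = jloop Σ₁ Σ₂ }

{-# OPTIONS --safe #-}
-- A minimal coloration of maximum deficiency M of a graph with even chromatic number χ = 2k uses
-- f opposite pairs ±x and h unpaired colors, and minimality of χ forces f + h = k and M = h.
-- In a proper coloration of the all-positive join the two sides use disjoint colors, and in an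
-- exceptional graph every proper coloration uses at least s = χ − M colors and avoids 0 when it
-- uses exactly s. So coloring the join from a color set of size m ≤ s₁ + s₂ would take exactly
-- s₁ + s₂ nonzero colors out of at most 2⌊m/2⌋, making s₁ + s₂ even, whereas s₁ + s₂ is
-- 2f₁ + h₁ + 2f₂ + h₂ with h₁ − h₂ = M₁ − M₂ odd. Conversely, writing h₁ = h₂ + 2b + 1, the
-- hypothesis on χ₁ says b ≤ f₂, and breaking b pairs of Σ₂ into unpaired negative colors fits
-- both palettes into the s₁ + s₂ + 1 colors ±1, …, ±(f₁ + h₁ + f₂ − b).
module Submission where

open import Defs
open import Data.Nat using (ℕ; _+_; _∸_; _≤_; _<_)
open import Data.Sum using (_⊎_)
open import Data.Product using (_×_)

open import Data.Bool using (Bool; true; false; if_then_else_; _∧_; _∨_; _xor_)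
open import Data.Bool.Properties using (∨-zeroʳ)
open import Data.Empty using (⊥; ⊥-elim)
open import Data.Fin as Fin using (Fin; toℕ; _↑ˡ_; _↑ʳ_; splitAt)
open import Data.Fin.Properties
  using (any?; toℕ-injective; toℕ<n; toℕ-fromℕ<; splitAt-↑ˡ; splitAt-↑ʳ; splitAt⁻¹-↑ˡ; splitAt⁻¹-↑ʳ)
open import Data.Integer using (ℤ; +_; -[1+_]; 0ℤ; ∣_∣; -_; sign; _◃_)
import Data.Integer as ℤ
import Data.Integer.Properties as ℤₚ
open import Data.List using (List; []; _∷_; _++_; length; map; tabulate; deduplicate; filter)
open import Data.List.Membership.Propositional using (_∈_)
open import Data.List.Membership.Propositional.Properties
  using (∈-tabulate⁺; ∈-tabulate⁻; ∈-deduplicate⁺; ∈-deduplicate⁻; ∈-filter⁺; ∈-filter⁻; ∈-map⁺; ∈-map⁻;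
         ∈-++⁺ˡ; ∈-++⁺ʳ; ∈-++⁻)
open import Data.List.Properties
  using (length-tabulate; tabulate-cong; length-map; length-++; filter-notAll)
open import Data.List.Relation.Binary.Subset.Propositional using (_⊆_)
open import Data.List.Relation.Unary.All as All using ([]; _∷_)
open import Data.List.Relation.Unary.AllPairs using ([]; _∷_)
open import Data.List.Relation.Unary.Any as Any using (here; there)
open import Data.List.Relation.Unary.Unique.Propositional using (Unique)
open import Data.List.Relation.Unary.Unique.Propositional.Properties using (tabulate⁺; map⁺; filter⁺; ++⁺)
open import Data.List.Relation.Unary.Unique.DecPropositional.Properties using (deduplicate-!)
open import Data.Nat as ℕ using (suc; zero; s≤s; z≤n; _*_; _%_; _/_; _<?_)
open import Data.Nat.DivMod using (m*n%n≡0; m≡m%n+[m/n]*n; m*n/n≡m; m/n*n≤m; /-congˡ; /-monoˡ-≤)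
open import Data.Nat.Properties
open import Data.Nat.Tactic.RingSolver using (solve-∀)
open import Data.List.Extrema ≤-totalOrder using (max; xs≤max)
open import Data.Product as Product using (∃-syntax; _,_; proj₁; proj₂)
open import Data.Product.Properties using (≡-dec)
open import Data.Sign as Sign using (Sign; opposite)
open import Data.Sign.Properties using (s≢opposite[s])
open import Data.Sum using (inj₁; inj₂; [_,_]′)
open import Function using (_∘_)
open import Relation.Binary.Definitions using (DecidableEquality; tri<; tri≈; tri>)
open import Relation.Binary.PropositionalEquality
open import Relation.Nullary using (¬_; ¬?; Dec; yes; no; does)
open import Relation.Nullary.Decidable using (dec-true; dec-false)

-- Arithmetic

even⇒≡2*half : ∀ {m} → Even m → m ≡ 2 * (m / 2)
even⇒≡2*half {m} even = trans (m≡m%n+[m/n]*n m 2) (trans (cong (_+ (m / 2) * 2) even) (*-comm (m / 2) 2))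

odd⇒≡1+2*half : ∀ {m} → Odd m → m ≡ suc (2 * (m / 2))
odd⇒≡1+2*half {m} odd =
  trans (m≡m%n+[m/n]*n m 2) (trans (cong (_+ (m / 2) * 2) odd) (cong suc (*-comm (m / 2) 2)))

odd-difference : ∀ {M₁ M₂} → M₂ < M₁ → (Odd M₁ × Even M₂) ⊎ (Even M₁ × Odd M₂) → ∃[ b ] M₁ ≡ M₂ + suc (2 * b)
odd-difference {M₁} {M₂} M₂<M₁ (inj₁ (odd₁ , even₂))
  with M₁ / 2 | odd⇒≡1+2*half {M₁} odd₁ | M₂ / 2 | even⇒≡2*half {M₂} even₂
... | q₁ | refl | q₂ | refl with b , refl ← m≤n⇒∃[o]m+o≡n {q₂} {q₁} (*-cancelˡ-≤ 2 (≤-pred M₂<M₁)) =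
  b , regroup q₂ b
  where
  regroup : ∀ q b → suc (2 * (q + b)) ≡ 2 * q + suc (2 * b)
  regroup = solve-∀
odd-difference {M₁} {M₂} M₂<M₁ (inj₂ (even₁ , odd₂))
  with M₁ / 2 | even⇒≡2*half {M₁} even₁ | M₂ / 2 | odd⇒≡1+2*half {M₂} odd₂
... | q₁ | refl | q₂ | refl
  with b , refl ← m≤n⇒∃[o]m+o≡n {suc q₂} {q₁} (*-cancelˡ-< 2 q₂ q₁ (<-trans (n<1+n _) M₂<M₁)) =
  b , regroup q₂ b
  where
  regroup : ∀ q b → 2 * (suc q + b) ≡ suc (2 * q) + suc (2 * b)
  regroup = solve-∀

≤-half : ∀ {a m} → 2 * a ≤ m → a ≤ m / 2
≤-half {a} {m} 2a≤m = subst (_≤ m / 2) (trans (/-congˡ (*-comm 2 a)) (m*n/n≡m a 2)) (/-monoˡ-≤ 2 2a≤m)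

2*[m/2]≤m : ∀ m → 2 * (m / 2) ≤ m
2*[m/2]≤m m = subst (_≤ m) (*-comm (m / 2) 2) (m/n*n≤m m 2)

≤-+-tight : ∀ {s₁ s₂ t₁ t₂} → s₁ ≤ t₁ → s₂ ≤ t₂ → t₁ + t₂ ≤ s₁ + s₂ → t₁ ≡ s₁ × t₂ ≡ s₂
≤-+-tight {s₁} {s₂} {t₁} {t₂} s₁≤t₁ s₂≤t₂ t≤s =
  ≤-antisym (+-cancelʳ-≤ t₂ t₁ s₁ (≤-trans t≤s (+-monoʳ-≤ s₁ s₂≤t₂))) s₁≤t₁ ,
  ≤-antisym (+-cancelˡ-≤ t₁ t₂ s₂ (≤-trans t≤s (+-monoˡ-≤ s₂ s₁≤t₁))) s₂≤t₂

<∧≤⇒≢ : ∀ {a x b} → a < x → x ≤ b → a ≢ b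
<∧≤⇒≢ a<x x≤b refl = <-irrefl refl (<-≤-trans a<x x≤b)

discrete-intermediate-value : ∀ (f : ℕ → ℕ) {s} N → f 0 < s → s ≤ f N →
                              (∀ j → f (suc j) ≤ suc (f j)) → ∃[ j ] f (suc j) ≡ s
discrete-intermediate-value f zero f0<s s≤fN _ = ⊥-elim (<⇒≱ f0<s s≤fN)
discrete-intermediate-value f {s} (suc N) f0<s s≤fN slow with s ≤? f N
... | yes s≤fN-1 = discrete-intermediate-value f N f0<s s≤fN-1 slow
... | no s≰fN-1 = N , ≤-antisym (≤-trans (slow N) (≰⇒> s≰fN-1)) s≤fN

-- Ranks of Boolean predicates

bit : Bool → ℕ
bit true = 1
bit false = 0

rank : (ℕ → Bool) → ℕ → ℕ
rank p zero = 0
rank p (suc i) = bit (p i) + rank p i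

module _ {p : ℕ → Bool} where

  rank-≤-suc : ∀ i → rank p i ≤ rank p (suc i)
  rank-≤-suc i = m≤n+m (rank p i) (bit (p i))

  rank-mono : ∀ {i j} → i ≤ j → rank p i ≤ rank p j
  rank-mono {j = zero} z≤n = ≤-refl
  rank-mono {i} {suc j} i≤1+j with m≤n⇒m<n∨m≡n i≤1+j
  ... | inj₁ i<1+j = ≤-trans (rank-mono (≤-pred i<1+j)) (rank-≤-suc j)
  ... | inj₂ refl = ≤-refl

  rank-< : ∀ {i j} → p i ≡ true → i < j → rank p i < rank p j
  rank-< {i} pi i<j = ≤-trans (≤-reflexive (cong (λ b → bit b + rank p i) (sym pi))) (rank-mono i<j)

  rank-injective : ∀ {i j} → p i ≡ true → p j ≡ true → rank p i ≡ rank p j → i ≡ j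
  rank-injective {i} {j} pi pj eq with <-cmp i j
  ... | tri< i<j _ _ = ⊥-elim (<-irrefl eq (rank-< pi i<j))
  ... | tri≈ _ i≡j _ = i≡j
  ... | tri> _ _ j<i = ⊥-elim (<-irrefl (sym eq) (rank-< pj j<i))

rank+rank≤ : ∀ (p q : ℕ → Bool) → (∀ i → p i ∧ q i ≡ false) → ∀ k → rank p k + rank q k ≤ k
rank+rank≤ p q disjoint zero = z≤n
rank+rank≤ p q disjoint (suc k) with p k | q k | disjoint k | rank+rank≤ p q disjoint k
... | true | true | () | _
... | true | false | _ | ih = s≤s ih
... | false | true | _ | ih = subst (_≤ suc k) (sym (+-suc _ _)) (s≤s ih)
... | false | false | _ | ih = m≤n⇒m≤1+n ih

∨⇒xor : ∀ a b → a ∨ b ≡ true → a ∧ b ≡ false → a xor b ≡ true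
∨⇒xor true true _ ()
∨⇒xor true false _ _ = refl
∨⇒xor false true _ _ = refl

∧-xor-disjoint : ∀ a b → (a ∧ b) ∧ (a xor b) ≡ false
∧-xor-disjoint true true = refl
∧-xor-disjoint true false = refl
∧-xor-disjoint false _ = refl

2*bit∧+bitxor : ∀ a b → 2 * bit (a ∧ b) + bit (a xor b) ≡ bit a + bit b
2*bit∧+bitxor true true = refl
2*bit∧+bitxor true false = refl
2*bit∧+bitxor false true = refl
2*bit∧+bitxor false false = refl

-- Counting colors

unique∧⊆⇒length≤ : ∀ {A : Set} → DecidableEquality A → {xs ys : List A} →
                   Unique xs → xs ⊆ ys → length xs ≤ length ys
unique∧⊆⇒length≤ _≟_ {[]} _ _ = z≤n
unique∧⊆⇒length≤ _≟_ {x ∷ xs} {ys} (x∉xs ∷ unique) xs⊆ys =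
  ≤-trans (s≤s (unique∧⊆⇒length≤ _≟_ unique xs⊆ys-without-x))
          (filter-notAll (λ y → ¬? (x ≟ y)) ys (Any.map (λ x≡y x≢y → x≢y x≡y) (xs⊆ys (here refl))))
  where
  xs⊆ys-without-x : xs ⊆ filter (λ y → ¬? (x ≟ y)) ys
  xs⊆ys-without-x z∈xs = ∈-filter⁺ _ (xs⊆ys (there z∈xs)) (All.lookup x∉xs z∈xs)

length-filter-pair : ∀ {A : Set} {P : A → Set} (P? : ∀ x → Dec (P x)) x y →
                     length (filter P? (x ∷ y ∷ [])) ≡ bit (does (P? x)) + bit (does (P? y))
length-filter-pair P? x y with does (P? x)
... | true with does (P? y)
...   | true = refl
...   | false = refl
length-filter-pair P? x y | false with does (P? y)
...   | true = refl
...   | false = refl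

usedColors : (G : SignedGraph) → Coloration G → List ℤ
usedColors G κ = deduplicate ℤ._≟_ (tabulate κ)

module _ (G : SignedGraph) (κ : Coloration G) where

  ∈-usedColors⁺ : ∀ v → κ v ∈ usedColors G κ
  ∈-usedColors⁺ v = ∈-deduplicate⁺ ℤ._≟_ (∈-tabulate⁺ v)

  ∈-usedColors⁻ : ∀ {z} → z ∈ usedColors G κ → ∃[ v ] z ≡ κ v
  ∈-usedColors⁻ z∈ = ∈-tabulate⁻ (∈-deduplicate⁻ ℤ._≟_ (tabulate κ) z∈)

  colorsUsed≤length : ∀ ys → (∀ v → κ v ∈ ys) → colorsUsed G κ ≤ length ys
  colorsUsed≤length ys covers = unique∧⊆⇒length≤ ℤ._≟_ (deduplicate-! ℤ._≟_ (tabulate κ))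
    λ z∈ → let v , z≡κv = ∈-usedColors⁻ z∈ in subst (_∈ ys) (sym z≡κv) (covers v)

  length≤colorsUsed : ∀ ys → Unique ys → (∀ {z} → z ∈ ys → ∃[ v ] z ≡ κ v) → length ys ≤ colorsUsed G κ
  length≤colorsUsed ys unique onto = unique∧⊆⇒length≤ ℤ._≟_ unique
    λ z∈ → let v , z≡κv = onto z∈ in subst (_∈ usedColors G κ) (sym z≡κv) (∈-usedColors⁺ v)

  colorsUsed≤n : colorsUsed G κ ≤ n G
  colorsUsed≤n = subst (colorsUsed G κ ≤_) (length-tabulate κ) (colorsUsed≤length _ ∈-tabulate⁺)

  injective⇒n≤colorsUsed : (∀ {v w} → κ v ≡ κ w → v ≡ w) → n G ≤ colorsUsed G κ
  injective⇒n≤colorsUsed injective =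
    subst (_≤ colorsUsed G κ) (length-tabulate κ) (length≤colorsUsed _ (tabulate⁺ injective) ∈-tabulate⁻)

colorsUsed-resp : ∀ (G : SignedGraph) {κ κ′ : Coloration G} → (∀ v → κ v ≡ κ′ v) →
                  colorsUsed G κ ≡ colorsUsed G κ′
colorsUsed-resp G κ≗κ′ = cong (length ∘ deduplicate ℤ._≟_) (tabulate-cong κ≗κ′)

proper-resp : ∀ (G : SignedGraph) {κ κ′ : Coloration G} → (∀ v → κ v ≡ κ′ v) → Proper G κ → Proper G κ′
proper-resp G κ≗κ′ proper a b rewrite sym (κ≗κ′ a) | sym (κ≗κ′ b) = proper a b

-- Signed colors

-- (s , i) is the color of sign s and absolute value i + 1
⟦_⟧ : Sign × ℕ → ℤ
⟦ s , i ⟧ = s ◃ suc i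

⊖_ : Sign × ℕ → Sign × ℕ
⊖ p = opposite (proj₁ p) , proj₂ p

toSigned : ℤ → Sign × ℕ
toSigned x = sign x , ℕ.pred ∣ x ∣

⟦⟧-injective : ∀ {p q} → ⟦ p ⟧ ≡ ⟦ q ⟧ → p ≡ q
⟦⟧-injective eq = cong₂ _,_ (ℤₚ.sign-cong eq) (suc-injective (ℤₚ.abs-cong eq))

⟦⊖⟧ : ∀ p → ⟦ ⊖ p ⟧ ≡ - ⟦ p ⟧
⟦⊖⟧ (Sign.+ , i) = refl
⟦⊖⟧ (Sign.- , i) = refl

p≢⊖p : ∀ p → p ≢ ⊖ p
p≢⊖p p eq = s≢opposite[s] (proj₁ p) (cong proj₁ eq)

sign-dichotomy : ∀ s t → s ≡ t ⊎ t ≡ opposite s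
sign-dichotomy Sign.+ Sign.+ = inj₁ refl
sign-dichotomy Sign.+ Sign.- = inj₂ refl
sign-dichotomy Sign.- Sign.+ = inj₂ refl
sign-dichotomy Sign.- Sign.- = inj₁ refl

even-colorSet⁻ : ∀ {k x} → InColorSet (2 * k) x → x ≡ ⟦ toSigned x ⟧ × proj₂ (toSigned x) < k
even-colorSet⁻ {k} (inj₁ (_ , odd)) =
  ⊥-elim (0≢1+n (trans (sym (m*n%n≡0 k 2)) (trans (cong (_% 2) (*-comm k 2)) odd)))
even-colorSet⁻ {k} {+ zero} (inj₂ (x≢0 , _)) = ⊥-elim (x≢0 refl)
even-colorSet⁻ {k} {+ suc i} (inj₂ (_ , 2∣x∣≤2k)) = refl , *-cancelˡ-≤ 2 2∣x∣≤2k
even-colorSet⁻ {k} { -[1+ i ]} (inj₂ (_ , 2∣x∣≤2k)) = refl , *-cancelˡ-≤ 2 2∣x∣≤2k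

even-colorSet⁺ : ∀ {k} p → proj₂ p < k → InColorSet (2 * k) ⟦ p ⟧
even-colorSet⁺ (s , i) i<k =
  inj₂ (⟦⟧≢0 , subst (λ a → 2 * a ≤ _) (sym (ℤₚ.abs-◃ s (suc i))) (*-monoʳ-≤ 2 i<k))
  where
  ⟦⟧≢0 : ⟦ s , i ⟧ ≢ 0ℤ
  ⟦⟧≢0 eq = 0≢1+n (trans (sym (cong ∣_∣ eq)) (ℤₚ.abs-◃ s (suc i)))

inSet-even : ∀ (G : SignedGraph) {k} (c : Fin (n G) → Sign × ℕ) → (∀ v → proj₂ (c v) < k) →
             InSet G (2 * k) (⟦_⟧ ∘ c)
inSet-even G c bounded v = even-colorSet⁺ (c v) (bounded v)

nonzeroColors : ℕ → List ℤ
nonzeroColors zero = []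
nonzeroColors (suc q) = ⟦ Sign.+ , q ⟧ ∷ ⟦ Sign.- , q ⟧ ∷ nonzeroColors q

length-nonzeroColors : ∀ q → length (nonzeroColors q) ≡ 2 * q
length-nonzeroColors zero = refl
length-nonzeroColors (suc q) = trans (cong (λ l → suc (suc l)) (length-nonzeroColors q)) (sym (*-suc 2 q))

∈-nonzeroColors : ∀ {q} p → proj₂ p < q → ⟦ p ⟧ ∈ nonzeroColors q
∈-nonzeroColors {suc q} (s , i) i<1+q with m<1+n⇒m<n∨m≡n i<1+q
... | inj₁ i<q = there (there (∈-nonzeroColors (s , i) i<q))
∈-nonzeroColors (Sign.+ , i) _ | inj₂ refl = here refl
∈-nonzeroColors (Sign.- , i) _ | inj₂ refl = there (here refl)

∈-nonzeroColors-half : ∀ {m x} → x ≢ 0ℤ → 2 * ∣ x ∣ ≤ m → x ∈ nonzeroColors (m / 2)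
∈-nonzeroColors-half {x = + zero} x≢0 _ = ⊥-elim (x≢0 refl)
∈-nonzeroColors-half {x = + suc i} _ 2∣x∣≤m = ∈-nonzeroColors (Sign.+ , i) (≤-half 2∣x∣≤m)
∈-nonzeroColors-half {x = -[1+ i ]} _ 2∣x∣≤m = ∈-nonzeroColors (Sign.- , i) (≤-half 2∣x∣≤m)

module _ (G : SignedGraph) {m} {κ : Coloration G} (inSet : InSet G m κ) where

  colorsUsed≤2*[size/2] : (∀ v → κ v ≢ 0ℤ) → colorsUsed G κ ≤ 2 * (m / 2)
  colorsUsed≤2*[size/2] nonzero = subst (colorsUsed G κ ≤_) (length-nonzeroColors (m / 2))
    (colorsUsed≤length G κ _ λ v → nonzeroColor v (inSet v))
    where
    nonzeroColor : ∀ v → InColorSet m (κ v) → κ v ∈ nonzeroColors (m / 2)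
    nonzeroColor v (inj₁ (κv≡0 , _)) = ⊥-elim (nonzero v κv≡0)
    nonzeroColor v (inj₂ (κv≢0 , bounded)) = ∈-nonzeroColors-half κv≢0 bounded

  colorsUsed≤size : colorsUsed G κ ≤ m
  colorsUsed≤size with any? (λ v → κ v ℤ.≟ 0ℤ)
  ... | no ¬zero = ≤-trans (colorsUsed≤2*[size/2] (λ v κv≡0 → ¬zero (v , κv≡0))) (2*[m/2]≤m m)
  ... | yes (w , κw≡0) with inSet w
  ...   | inj₂ (κw≢0 , _) = ⊥-elim (κw≢0 κw≡0)
  ...   | inj₁ (_ , odd) =
    subst (colorsUsed G κ ≤_) (trans (cong suc (length-nonzeroColors (m / 2))) (sym (odd⇒≡1+2*half odd)))
          (colorsUsed≤length G κ (0ℤ ∷ nonzeroColors (m / 2)) color)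
    where
    color : ∀ v → κ v ∈ 0ℤ ∷ nonzeroColors (m / 2)
    color v with κ v ℤ.≟ 0ℤ | inSet v
    ... | yes κv≡0 | _ = here κv≡0
    ... | no κv≢0 | inj₁ (κv≡0 , _) = ⊥-elim (κv≢0 κv≡0)
    ... | no _ | inj₂ (κv≢0 , bounded) = there (∈-nonzeroColors-half κv≢0 bounded)

Separating : (Sign × ℕ → Set) → (Sign × ℕ → Sign × ℕ) → Set
Separating U ρ = ∀ {p q} → U p → U q → proj₂ (ρ p) ≡ proj₂ (ρ q) → p ≡ q ⊎ (q ≡ ⊖ p × ρ q ≡ ⊖ ρ p)

-- A recoloring that merges no two colors and creates no new pair ±x keeps colorations proper.
separating⇒proper : ∀ (G : SignedGraph) {U ρ} (c : Fin (n G) → Sign × ℕ) →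
                    Proper G (⟦_⟧ ∘ c) → (∀ v → U (c v)) → Separating U ρ → Proper G (⟦_⟧ ∘ ρ ∘ c)
separating⇒proper G {U} {ρ} c proper inU separating a b = positive , negative
  where
  positive : edge G a b ≡ pos → ⟦ ρ (c a) ⟧ ≢ ⟦ ρ (c b) ⟧
  positive is-pos eq with separating (inU a) (inU b) (cong proj₂ (⟦⟧-injective eq))
  ... | inj₁ ca≡cb = proj₁ (proper a b) is-pos (cong ⟦_⟧ ca≡cb)
  ... | inj₂ (_ , ρcb≡⊖ρca) = p≢⊖p (ρ (c a)) (trans (⟦⟧-injective eq) ρcb≡⊖ρca)
  opposed : edge G a b ≡ neg → ρ (c a) ≢ ⊖ ρ (c b)
  opposed is-neg ρca≡⊖ρcb with separating (inU a) (inU b) (cong proj₂ ρca≡⊖ρcb)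
  ... | inj₁ ca≡cb = p≢⊖p (ρ (c a)) (trans ρca≡⊖ρcb (cong (⊖_ ∘ ρ) (sym ca≡cb)))
  ... | inj₂ (cb≡⊖ca , _) = proj₂ (proper a b) is-neg (begin
    ⟦ c a ⟧       ≡⟨ ℤₚ.neg-involutive _ ⟨
    - - ⟦ c a ⟧   ≡⟨ cong -_ (⟦⊖⟧ (c a)) ⟨
    - ⟦ ⊖ c a ⟧   ≡⟨ cong (-_ ∘ ⟦_⟧) cb≡⊖ca ⟨
    - ⟦ c b ⟧     ∎)
    where open ≡-Reasoning
  negative : edge G a b ≡ neg → ⟦ ρ (c a) ⟧ ≢ - ⟦ ρ (c b) ⟧
  negative is-neg eq = opposed is-neg (⟦⟧-injective (trans eq (sym (⟦⊖⟧ (ρ (c b))))))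

-- Exceptional graphs

distinct-ends : ∀ (G : SignedGraph) {a b ℓ} → edge G a b ≡ ℓ → ℓ ≢ none → a ≢ b
distinct-ends G {a} edge≡ℓ ℓ≢none refl = ℓ≢none (trans (sym edge≡ℓ) (loopless G a))

module Freshening (G : SignedGraph) (κ : Coloration G) where

  bound : ℕ
  bound = suc (max 0 (tabulate (∣_∣ ∘ κ)))

  fresh : Fin (n G) → ℤ
  fresh v = + (bound + toℕ v)

  ∣κ∣<∣fresh∣ : ∀ v w → ∣ κ w ∣ < ∣ fresh v ∣
  ∣κ∣<∣fresh∣ v w = s≤s (≤-trans (All.lookup (xs≤max 0 _) (∈-tabulate⁺ w)) (m≤m+n _ (toℕ v)))

  fresh≢κ : ∀ v w → fresh v ≢ κ w
  fresh≢κ v w eq = <-irrefl (cong ∣_∣ (sym eq)) (∣κ∣<∣fresh∣ v w)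

  fresh≢-κ : ∀ v w → fresh v ≢ - κ w
  fresh≢-κ v w eq = <-irrefl (trans (sym (ℤₚ.∣-i∣≡∣i∣ (κ w))) (cong ∣_∣ (sym eq))) (∣κ∣<∣fresh∣ v w)

  fresh-injective : ∀ {v w} → fresh v ≡ fresh w → v ≡ w
  fresh-injective eq = toℕ-injective (+-cancelˡ-≡ bound _ _ (ℤₚ.+-injective eq))

  recolor : ℕ → Coloration G
  recolor j v = if does (toℕ v <? j) then fresh v else κ v

  recolor-fresh : ∀ {j v} → toℕ v < j → recolor j v ≡ fresh v
  recolor-fresh {j} {v} v<j rewrite dec-true (toℕ v <? j) v<j = refl

  recolor-old : ∀ {j v} → ¬ toℕ v < j → recolor j v ≡ κ v
  recolor-old {j} {v} v≮j rewrite dec-false (toℕ v <? j) v≮j = refl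

  recolor-proper : Proper G κ → ∀ j → Proper G (recolor j)
  recolor-proper proper j a b with toℕ a <? j | toℕ b <? j
  ... | yes a<j | yes b<j rewrite recolor-fresh a<j | recolor-fresh b<j =
    (λ is-pos e → distinct-ends G is-pos (λ ()) (fresh-injective e)) , λ _ ()
  ... | yes a<j | no b≮j rewrite recolor-fresh a<j | recolor-old b≮j =
    (λ _ → fresh≢κ a b) , λ _ → fresh≢-κ a b
  ... | no a≮j | yes b<j rewrite recolor-old a≮j | recolor-fresh b<j =
    (λ _ e → fresh≢κ b a (sym e)) , λ _ e → fresh≢-κ b a (trans (sym (ℤₚ.neg-involutive _)) (cong -_ (sym e)))
  ... | no a≮j | no b≮j rewrite recolor-old a≮j | recolor-old b≮j = proper a b

  recolor-step : ∀ j v → recolor (suc j) v ∈ + (bound + j) ∷ usedColors G (recolor j)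
  recolor-step j v with <-cmp (toℕ v) j
  ... | tri< v<j _ _ rewrite recolor-fresh (m<n⇒m<1+n v<j) =
    there (subst (_∈ usedColors G (recolor j)) (recolor-fresh v<j) (∈-usedColors⁺ G (recolor j) v))
  ... | tri≈ _ refl _ rewrite recolor-fresh (n<1+n j) = here refl
  ... | tri> _ _ j<v rewrite recolor-old (≤⇒≯ j<v) =
    there (subst (_∈ usedColors G (recolor j)) (recolor-old (<⇒≯ j<v)) (∈-usedColors⁺ G (recolor j) v))

  colorsUsed-recolor-suc : ∀ j → colorsUsed G (recolor (suc j)) ≤ suc (colorsUsed G (recolor j))
  colorsUsed-recolor-suc j = colorsUsed≤length G (recolor (suc j)) _ (recolor-step j)

  n≤colorsUsed-recolor : n G ≤ colorsUsed G (recolor (n G))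
  n≤colorsUsed-recolor = injective⇒n≤colorsUsed G (recolor (n G)) λ {v} {w} eq →
    fresh-injective (trans (sym (recolor-fresh (toℕ<n v))) (trans eq (recolor-fresh (toℕ<n w))))

  fresh-only-at : ∀ {j v} a → toℕ v < j → recolor j a ≡ fresh v → a ≡ v
  fresh-only-at {j} {v} a v<j eq with toℕ a <? j
  ... | yes a<j = fresh-injective (trans (sym (recolor-fresh a<j)) eq)
  ... | no a≮j = ⊥-elim (fresh≢κ v a (sym (trans (sym (recolor-old a≮j)) eq)))

-- Recoloring the vertices one at a time with fresh colors raises the number of colors by at most
-- one per step; at the step where it reaches χ − M the freshest color sits on a single vertex,
-- so it cannot lie on both ends of a negative edge.
exceptional⇒χ≤colorsUsed+M : ∀ G {χ M} → Exceptional G χ M → ∀ κ → Proper G κ → χ ≤ colorsUsed G κ + M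
exceptional⇒χ≤colorsUsed+M G {χ} {M} (_ , _ , ((κ* , _ , used*+M≡χ) , _) , exceptional) κ proper
  with colorsUsed G κ* ≤? colorsUsed G κ
... | yes s≤t = subst (_≤ colorsUsed G κ + M) used*+M≡χ (+-monoˡ-≤ M s≤t)
... | no s≰t = ⊥-elim (reaching-s (discrete-intermediate-value (λ j → colorsUsed G (recolor j)) (n G)
                 (≰⇒> s≰t) (≤-trans (colorsUsed≤n G κ*) n≤colorsUsed-recolor) colorsUsed-recolor-suc))
  where
  open Freshening G κ
  0<n : 0 < n G
  0<n = <-≤-trans (≤-<-trans z≤n (≰⇒> s≰t)) (colorsUsed≤n G κ*)
  v₀ : Fin (n G)
  v₀ = Fin.fromℕ< 0<n
  v₀<1+j : ∀ j → toℕ v₀ < suc j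
  v₀<1+j j = subst (_< suc j) (sym (toℕ-fromℕ< 0<n)) (s≤s z≤n)
  reaching-s : ∃[ j ] colorsUsed G (recolor (suc j)) ≡ colorsUsed G κ* → ⊥
  reaching-s (j , used≡s) with exceptional (recolor (suc j)) (recolor-proper proper (suc j))
                                          (trans (cong (_+ M) used≡s) used*+M≡χ) v₀
  ... | a , b , negative , a~v₀ , b~v₀ =
    distinct-ends G negative (λ ()) (trans (alone a a~v₀) (sym (alone b b~v₀)))
    where
    alone : ∀ a → recolor (suc j) a ≡ recolor (suc j) v₀ → a ≡ v₀
    alone a eq = fresh-only-at a (v₀<1+j j) (trans eq (recolor-fresh (v₀<1+j j)))

exceptional⇒nonzero : ∀ G {χ M κ} → Exceptional G χ M → Proper G κ → colorsUsed G κ + M ≡ χ → ∀ v → κ v ≢ 0ℤ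
exceptional⇒nonzero G {κ = κ} (_ , _ , _ , exceptional) proper tight v κv≡0
  with exceptional κ proper tight v
... | a , b , negative , κa≡κv , κb≡κv =
  proj₂ (proper a b) negative (trans (trans κa≡κv κv≡0) (sym (cong -_ (trans κb≡κv κv≡0))))

-- Normal form of a minimal coloration

-- the palette ±1, …, ±f, f + 1, …, f + h
InPalette : ℕ → ℕ → Sign × ℕ → Set
InPalette f h (s , i) = i < f ⊎ (s ≡ Sign.+ × i < f + h)

inPalette⇒< : ∀ {f h} p → InPalette f h p → proj₂ p < f + h
inPalette⇒< _ (inj₁ i<f) = <-≤-trans i<f (m≤m+n _ _)
inPalette⇒< _ (inj₂ (_ , i<f+h)) = i<f+h

record NormalForm (G : SignedGraph) (χ M : ℕ) : Set where
  field
    pairs singles : ℕ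
    χ≡ : χ ≡ 2 * (pairs + singles)
    M≡ : M ≡ singles
    coloring : Fin (n G) → Sign × ℕ
    proper : Proper G (⟦_⟧ ∘ coloring)
    inPalette : ∀ v → InPalette pairs singles (coloring v)

open NormalForm using (pairs; singles)

module Profile (G : SignedGraph) (k : ℕ) (c : Fin (n G) → Sign × ℕ) (c<k : ∀ v → proj₂ (c v) < k) where

  Occurs : Sign × ℕ → Set
  Occurs p = ∃[ v ] p ≡ c v

  occurs? : ∀ p → Dec (Occurs p)
  occurs? p = any? (λ v → ≡-dec Sign._≟_ ℕ._≟_ p (c v))

  has : Sign → ℕ → Bool
  has s i = does (occurs? (s , i))

  full half : ℕ → Bool
  full i = has Sign.+ i ∧ has Sign.- i
  half i = has Sign.+ i xor has Sign.- i

  f h : ℕ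
  f = rank full k
  h = rank half k

  occurs⇒< : ∀ {p} → Occurs p → proj₂ p < k
  occurs⇒< (v , refl) = c<k v

  occurs⇒has : ∀ {s i} → Occurs (s , i) → has s i ≡ true
  occurs⇒has {s} {i} = dec-true (occurs? (s , i))

  has⇒some : ∀ s {i} → has s i ≡ true → has Sign.+ i ∨ has Sign.- i ≡ true
  has⇒some Sign.+ {i} h₊ = cong (_∨ has Sign.- i) h₊
  has⇒some Sign.- {i} h₋ = trans (cong (has Sign.+ i ∨_) h₋) (∨-zeroʳ _)

  has⇒half : ∀ s {i} → has s i ≡ true → full i ≡ false → half i ≡ true
  has⇒half s {i} hs = ∨⇒xor (has Sign.+ i) (has Sign.- i) (has⇒some s hs)

  has-both⇒full : ∀ s {i} → has s i ≡ true → has (opposite s) i ≡ true → full i ≡ true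
  has-both⇒full Sign.+ h₊ h₋ = cong₂ _∧_ h₊ h₋
  has-both⇒full Sign.- h₋ h₊ = cong₂ _∧_ h₊ h₋

  f+h≤k : f + h ≤ k
  f+h≤k = rank+rank≤ full half (λ i → ∧-xor-disjoint (has Sign.+ i) (has Sign.- i)) k

  -- full pairs are packed onto ±1, …, ±f and the remaining colors onto f + 1, …, f + h
  compress : Sign × ℕ → Sign × ℕ
  compress (s , i) = if full i then (s , rank full i) else (Sign.+ , f + rank half i)

  compress-separating : Separating Occurs compress
  compress-separating {s , i} {t , j} occurs-p occurs-q eq with full i in fi | full j in fj
  ... | true | true with rank-injective {i = i} {j = j} fi fj eq
  ...   | refl with sign-dichotomy s t
  ...     | inj₁ refl = inj₁ refl
  ...     | inj₂ refl = inj₂ (refl , refl)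
  compress-separating {s , i} {t , j} occurs-p occurs-q eq | true | false =
    ⊥-elim (<-irrefl eq (<-≤-trans (rank-< fi (occurs⇒< occurs-p)) (m≤m+n f _)))
  compress-separating {s , i} {t , j} occurs-p occurs-q eq | false | true =
    ⊥-elim (<-irrefl (sym eq) (<-≤-trans (rank-< fj (occurs⇒< occurs-q)) (m≤m+n f _)))
  compress-separating {s , i} {t , j} occurs-p occurs-q eq | false | false
    with rank-injective {i = i} {j = j} (has⇒half s (occurs⇒has occurs-p) fi)
                                        (has⇒half t (occurs⇒has occurs-q) fj) (+-cancelˡ-≡ f _ _ eq)
  ... | refl with sign-dichotomy s t
  ...   | inj₁ refl = inj₁ refl
  ...   | inj₂ refl with () ← trans (sym (has-both⇒full s (occurs⇒has occurs-p) (occurs⇒has occurs-q))) fi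

  compress-inPalette : ∀ {p} → Occurs p → InPalette f h (compress p)
  compress-inPalette {s , i} occurs-p with full i in fi
  ... | true = inj₁ (rank-< fi (occurs⇒< occurs-p))
  ... | false = inj₂ (refl , +-monoʳ-< f (rank-< (has⇒half s (occurs⇒has occurs-p) fi) (occurs⇒< occurs-p)))

  occurringAt : ℕ → List (Sign × ℕ)
  occurringAt i = filter occurs? ((Sign.+ , i) ∷ (Sign.- , i) ∷ [])

  occurringBelow : ℕ → List (Sign × ℕ)
  occurringBelow zero = []
  occurringBelow (suc i) = occurringBelow i ++ occurringAt i

  length-occurringAt : ∀ i → length (occurringAt i) ≡ 2 * bit (full i) + bit (half i)
  length-occurringAt i =
    trans (length-filter-pair occurs? _ _) (sym (2*bit∧+bitxor (has Sign.+ i) (has Sign.- i)))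

  length-occurringBelow : ∀ i → length (occurringBelow i) ≡ 2 * rank full i + rank half i
  length-occurringBelow zero = refl
  length-occurringBelow (suc i) = begin
    length (occurringBelow i ++ occurringAt i)
      ≡⟨ length-++ (occurringBelow i) ⟩
    length (occurringBelow i) + length (occurringAt i)
      ≡⟨ cong₂ _+_ (length-occurringBelow i) (length-occurringAt i) ⟩
    (2 * rank full i + rank half i) + (2 * bit (full i) + bit (half i))
      ≡⟨ regroup (rank full i) (rank half i) (bit (full i)) (bit (half i)) ⟩
    2 * rank full (suc i) + rank half (suc i) ∎
    where
    open ≡-Reasoning
    regroup : ∀ F H a b → (2 * F + H) + (2 * a + b) ≡ 2 * (a + F) + (b + H)
    regroup = solve-∀

  ∈-occurringAt⁻ : ∀ {p i} → p ∈ occurringAt i → proj₂ p ≡ i × Occurs p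
  ∈-occurringAt⁻ p∈ with ∈-filter⁻ occurs? p∈
  ... | here refl , occurs-p = refl , occurs-p
  ... | there (here refl) , occurs-p = refl , occurs-p

  ∈-occurringBelow⁻ : ∀ {p} i → p ∈ occurringBelow i → proj₂ p < i × Occurs p
  ∈-occurringBelow⁻ (suc i) p∈ with ∈-++⁻ (occurringBelow i) p∈
  ... | inj₁ p∈below = Product.map₁ m<n⇒m<1+n (∈-occurringBelow⁻ i p∈below)
  ... | inj₂ p∈at = Product.map₁ (λ { refl → n<1+n _ }) (∈-occurringAt⁻ p∈at)

  ∈-occurringBelow⁺ : ∀ {p} i → Occurs p → proj₂ p < i → p ∈ occurringBelow i
  ∈-occurringBelow⁺ {s , j} (suc i) occurs-p j<1+i with m<1+n⇒m<n∨m≡n j<1+i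
  ... | inj₁ j<i = ∈-++⁺ˡ (∈-occurringBelow⁺ i occurs-p j<i)
  ... | inj₂ refl = ∈-++⁺ʳ (occurringBelow j) (∈-filter⁺ occurs? (candidate s) occurs-p)
    where
    candidate : ∀ s → (s , j) ∈ (Sign.+ , j) ∷ (Sign.- , j) ∷ []
    candidate Sign.+ = here refl
    candidate Sign.- = there (here refl)

  unique-occurringBelow : ∀ i → Unique (occurringBelow i)
  unique-occurringBelow zero = []
  unique-occurringBelow (suc i) =
    ++⁺ (unique-occurringBelow i) (filter⁺ occurs? (((λ ()) ∷ []) ∷ [] ∷ []))
        λ (p∈below , p∈at) → <-irrefl (proj₁ (∈-occurringAt⁻ p∈at)) (proj₁ (∈-occurringBelow⁻ i p∈below))

  colorsUsed≡2f+h : colorsUsed G (⟦_⟧ ∘ c) ≡ 2 * f + h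
  colorsUsed≡2f+h =
    trans (≤-antisym upper lower) (trans (length-map ⟦_⟧ (occurringBelow k)) (length-occurringBelow k))
    where
    upper : colorsUsed G (⟦_⟧ ∘ c) ≤ length (map ⟦_⟧ (occurringBelow k))
    upper = colorsUsed≤length G _ _ λ v → ∈-map⁺ ⟦_⟧ (∈-occurringBelow⁺ k (v , refl) (c<k v))
    lower : length (map ⟦_⟧ (occurringBelow k)) ≤ colorsUsed G (⟦_⟧ ∘ c)
    lower = length≤colorsUsed G _ _ (map⁺ ⟦⟧-injective (unique-occurringBelow k)) λ z∈ →
      let p , p∈ , z≡⟦p⟧ = ∈-map⁻ ⟦_⟧ z∈
          v , p≡cv = proj₂ (∈-occurringBelow⁻ k p∈)
      in v , trans z≡⟦p⟧ (cong ⟦_⟧ p≡cv)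

-- A minimal coloration of maximum deficiency M can be compressed onto the palette ±1, …, ±f,
-- f + 1, …, f + h; since χ = 2k is minimal, this palette cannot be smaller, which forces f + h = k
-- and M = 2k − (2f + h) = h.
normalForm : ∀ {G χ M} → IsChromatic G χ → Even χ → IsMaxDeficiency G χ M → NormalForm G χ M
normalForm {G} {χ} {M} (_ , χ-least) even ((κ , (proper , inSet) , used+M≡χ) , _) = record
  { pairs = f
  ; singles = h
  ; χ≡ = χ≡2[f+h]
  ; M≡ = M≡h
  ; coloring = compress ∘ c
  ; proper = separating⇒proper G c proper-c (λ v → v , refl) compress-separating
  ; inPalette = λ v → compress-inPalette (v , refl)
  }
  where
  k : ℕ
  k = χ / 2
  χ≡2k : χ ≡ 2 * k
  χ≡2k = even⇒≡2*half even
  c : Fin (n G) → Sign × ℕ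
  c v = toSigned (κ v)
  decomposed : ∀ v → κ v ≡ ⟦ c v ⟧ × proj₂ (c v) < k
  decomposed v = even-colorSet⁻ (subst (λ m → InColorSet m (κ v)) χ≡2k (inSet v))
  open Profile G k c (proj₂ ∘ decomposed)
  proper-c : Proper G (⟦_⟧ ∘ c)
  proper-c = proper-resp G (proj₁ ∘ decomposed) proper
  k≡f+h : k ≡ f + h
  k≡f+h = ≤-antisym (*-cancelˡ-≤ 2 (subst (_≤ 2 * (f + h)) χ≡2k (χ-least _ compressed))) f+h≤k
    where
    compressed : Colorable G (2 * (f + h))
    compressed = ⟦_⟧ ∘ compress ∘ c
               , separating⇒proper G c proper-c (λ v → v , refl) compress-separating
               , inSet-even G (compress ∘ c) (λ v → inPalette⇒< _ (compress-inPalette (v , refl)))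
  χ≡2[f+h] : χ ≡ 2 * (f + h)
  χ≡2[f+h] = trans χ≡2k (cong (2 *_) k≡f+h)
  M≡h : M ≡ h
  M≡h = +-cancelˡ-≡ (2 * f + h) M h (begin
    2 * f + h + M        ≡⟨ cong (_+ M) (trans (colorsUsed-resp G (proj₁ ∘ decomposed)) colorsUsed≡2f+h) ⟨
    colorsUsed G κ + M   ≡⟨ used+M≡χ ⟩
    χ                    ≡⟨ χ≡2[f+h] ⟩
    2 * (f + h)          ≡⟨ regroup f h ⟩
    2 * f + h + h        ∎)
    where
    open ≡-Reasoning
    regroup : ∀ f h → 2 * (f + h) ≡ 2 * f + h + h
    regroup = solve-∀

-- The all-positive join

module _ (Σ₁ Σ₂ : SignedGraph) where

  inl : Fin (n Σ₁) → Fin (n (Σ₁ ∨₊ Σ₂))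
  inl i = i ↑ˡ n Σ₂

  inr : Fin (n Σ₂) → Fin (n (Σ₁ ∨₊ Σ₂))
  inr j = n Σ₁ ↑ʳ j

  inl∨inr : ∀ w → (∃[ i ] inl i ≡ w) ⊎ (∃[ j ] inr j ≡ w)
  inl∨inr w with splitAt (n Σ₁) w in split≡
  ... | inj₁ i = inj₁ (i , splitAt⁻¹-↑ˡ split≡)
  ... | inj₂ j = inj₂ (j , splitAt⁻¹-↑ʳ split≡)

  edge-inl-inl : ∀ i j → edge (Σ₁ ∨₊ Σ₂) (inl i) (inl j) ≡ edge Σ₁ i j
  edge-inl-inl i j rewrite splitAt-↑ˡ (n Σ₁) i (n Σ₂) | splitAt-↑ˡ (n Σ₁) j (n Σ₂) = refl

  edge-inr-inr : ∀ i j → edge (Σ₁ ∨₊ Σ₂) (inr i) (inr j) ≡ edge Σ₂ i j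
  edge-inr-inr i j rewrite splitAt-↑ʳ (n Σ₁) (n Σ₂) i | splitAt-↑ʳ (n Σ₁) (n Σ₂) j = refl

  edge-inl-inr : ∀ i j → edge (Σ₁ ∨₊ Σ₂) (inl i) (inr j) ≡ pos
  edge-inl-inr i j rewrite splitAt-↑ˡ (n Σ₁) i (n Σ₂) | splitAt-↑ʳ (n Σ₁) (n Σ₂) j = refl

  module _ {κ : Coloration (Σ₁ ∨₊ Σ₂)} (proper : Proper (Σ₁ ∨₊ Σ₂) κ) where

    properˡ : Proper Σ₁ (κ ∘ inl)
    properˡ a b = (λ is-pos → proj₁ (proper _ _) (trans (edge-inl-inl a b) is-pos))
                , (λ is-neg → proj₂ (proper _ _) (trans (edge-inl-inl a b) is-neg))

    properʳ : Proper Σ₂ (κ ∘ inr)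
    properʳ a b = (λ is-pos → proj₁ (proper _ _) (trans (edge-inr-inr a b) is-pos))
                , (λ is-neg → proj₂ (proper _ _) (trans (edge-inr-inr a b) is-neg))

    -- the two sides of a proper coloration of the join share no color
    colorsUsedˡ+colorsUsedʳ≤colorsUsed :
      colorsUsed Σ₁ (κ ∘ inl) + colorsUsed Σ₂ (κ ∘ inr) ≤ colorsUsed (Σ₁ ∨₊ Σ₂) κ
    colorsUsedˡ+colorsUsedʳ≤colorsUsed =
      subst (_≤ colorsUsed (Σ₁ ∨₊ Σ₂) κ) (length-++ (usedColors Σ₁ (κ ∘ inl)))
        (length≤colorsUsed (Σ₁ ∨₊ Σ₂) κ _ (++⁺ (deduplicate-! ℤ._≟_ _) (deduplicate-! ℤ._≟_ _) disjoint) image)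
      where
      disjoint : ∀ {z} → ¬ (z ∈ usedColors Σ₁ (κ ∘ inl) × z ∈ usedColors Σ₂ (κ ∘ inr))
      disjoint (z∈ˡ , z∈ʳ) =
        let i , z≡κi = ∈-usedColors⁻ Σ₁ (κ ∘ inl) z∈ˡ
            j , z≡κj = ∈-usedColors⁻ Σ₂ (κ ∘ inr) z∈ʳ
        in proj₁ (proper (inl i) (inr j)) (edge-inl-inr i j) (trans (sym z≡κi) z≡κj)
      image : ∀ {z} → z ∈ usedColors Σ₁ (κ ∘ inl) ++ usedColors Σ₂ (κ ∘ inr) → ∃[ w ] z ≡ κ w
      image z∈ with ∈-++⁻ (usedColors Σ₁ (κ ∘ inl)) z∈
      ... | inj₁ z∈ˡ = let i , z≡κi = ∈-usedColors⁻ Σ₁ (κ ∘ inl) z∈ˡ in inl i , z≡κi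
      ... | inj₂ z∈ʳ = let j , z≡κj = ∈-usedColors⁻ Σ₂ (κ ∘ inr) z∈ʳ in inr j , z≡κj

  joinColoring : Coloration Σ₁ → Coloration Σ₂ → Coloration (Σ₁ ∨₊ Σ₂)
  joinColoring κ₁ κ₂ v = [ κ₁ , κ₂ ]′ (splitAt (n Σ₁) v)

  join-proper : ∀ {κ₁ κ₂} → Proper Σ₁ κ₁ → Proper Σ₂ κ₂ → (∀ i j → κ₁ i ≢ κ₂ j) →
                Proper (Σ₁ ∨₊ Σ₂) (joinColoring κ₁ κ₂)
  join-proper proper₁ proper₂ apart a b with splitAt (n Σ₁) a | splitAt (n Σ₁) b
  ... | inj₁ i | inj₁ j = proper₁ i j
  ... | inj₂ i | inj₂ j = proper₂ i j
  ... | inj₁ i | inj₂ j = (λ _ → apart i j) , λ ()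
  ... | inj₂ i | inj₁ j = (λ _ e → apart j i (sym e)) , λ ()

  join-inSet : ∀ {m κ₁ κ₂} → InSet Σ₁ m κ₁ → InSet Σ₂ m κ₂ → InSet (Σ₁ ∨₊ Σ₂) m (joinColoring κ₁ κ₂)
  join-inSet inSet₁ inSet₂ v with splitAt (n Σ₁) v
  ... | inj₁ i = inSet₁ i
  ... | inj₂ j = inSet₂ j

  -- A coloration of the join with at most s₁ + s₂ colors restricts to colorations of Σ₁ and
  -- Σ₂ with exactly s₁ and s₂ colors: by exceptionality none of them uses 0, and then the even
  -- count s₁ + s₂ of nonzero colors contradicts the parity of s₁ + s₂.
  join-lowerBound : ∀ {χ₁ χ₂ M₁ M₂ s₁ s₂ q m} → Exceptional Σ₁ χ₁ M₁ → Exceptional Σ₂ χ₂ M₂ →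
                    s₁ + M₁ ≡ χ₁ → s₂ + M₂ ≡ χ₂ → s₁ + s₂ ≡ suc (2 * q) →
                    Colorable (Σ₁ ∨₊ Σ₂) m → suc (s₁ + s₂) ≤ m
  join-lowerBound {M₁ = M₁} {M₂} {s₁} {s₂} {q} {m} exc₁ exc₂ s₁+M₁≡χ₁ s₂+M₂≡χ₂ odd (κ , proper , inSet) =
    ≮⇒≥ λ m<1+s → too-few (≤-pred m<1+s)
    where
    t₁ t₂ : ℕ
    t₁ = colorsUsed Σ₁ (κ ∘ inl)
    t₂ = colorsUsed Σ₂ (κ ∘ inr)
    s₁≤t₁ : s₁ ≤ t₁
    s₁≤t₁ = +-cancelʳ-≤ M₁ s₁ t₁
      (subst (_≤ t₁ + M₁) (sym s₁+M₁≡χ₁) (exceptional⇒χ≤colorsUsed+M Σ₁ exc₁ _ (properˡ {κ} proper)))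
    s₂≤t₂ : s₂ ≤ t₂
    s₂≤t₂ = +-cancelʳ-≤ M₂ s₂ t₂
      (subst (_≤ t₂ + M₂) (sym s₂+M₂≡χ₂) (exceptional⇒χ≤colorsUsed+M Σ₂ exc₂ _ (properʳ {κ} proper)))
    t₁+t₂≤used : t₁ + t₂ ≤ colorsUsed (Σ₁ ∨₊ Σ₂) κ
    t₁+t₂≤used = colorsUsedˡ+colorsUsedʳ≤colorsUsed {κ} proper
    too-few : m ≤ s₁ + s₂ → ⊥
    too-few m≤s with any? (λ w → κ w ℤ.≟ 0ℤ)
    ... | yes (w , κw≡0) = zero-free w κw≡0
      where
      tight : t₁ ≡ s₁ × t₂ ≡ s₂
      tight = ≤-+-tight s₁≤t₁ s₂≤t₂ (≤-trans t₁+t₂≤used (≤-trans (colorsUsed≤size (Σ₁ ∨₊ Σ₂) inSet) m≤s))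
      zero-free : ∀ w → κ w ≢ 0ℤ
      zero-free w with inl∨inr w
      ... | inj₁ (i , refl) =
        exceptional⇒nonzero Σ₁ exc₁ (properˡ {κ} proper) (trans (cong (_+ M₁) (proj₁ tight)) s₁+M₁≡χ₁) i
      ... | inj₂ (j , refl) =
        exceptional⇒nonzero Σ₂ exc₂ (properʳ {κ} proper) (trans (cong (_+ M₂) (proj₂ tight)) s₂+M₂≡χ₂) j
    ... | no ¬zero = even≢odd (m / 2) q (trans (sym s≡2[m/2]) odd)
      where
      used≤2[m/2] : colorsUsed (Σ₁ ∨₊ Σ₂) κ ≤ 2 * (m / 2)
      used≤2[m/2] = colorsUsed≤2*[size/2] (Σ₁ ∨₊ Σ₂) inSet λ w κw≡0 → ¬zero (w , κw≡0)
      s≡2[m/2] : s₁ + s₂ ≡ 2 * (m / 2)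
      s≡2[m/2] = ≤-antisym (≤-trans (+-mono-≤ s₁≤t₁ s₂≤t₂) (≤-trans t₁+t₂≤used used≤2[m/2]))
                           (≤-trans (2*[m/2]≤m m) m≤s)

signBit : Sign → ℕ
signBit Sign.+ = 0
signBit Sign.- = 1

2*+signBit-injective : ∀ {s t i j} → 2 * i + signBit s ≡ 2 * j + signBit t → (s , i) ≡ (t , j)
2*+signBit-injective {Sign.+} {Sign.+} {i} {j} eq =
  cong (Sign.+ ,_) (*-cancelˡ-≡ i j 2 (trans (sym (+-identityʳ (2 * i))) (trans eq (+-identityʳ (2 * j)))))
2*+signBit-injective {Sign.+} {Sign.-} {i} {j} eq =
  ⊥-elim (even≢odd i j (trans (sym (+-identityʳ (2 * i))) (trans eq (+-comm (2 * j) 1))))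
2*+signBit-injective {Sign.-} {Sign.+} {i} {j} eq =
  ⊥-elim (even≢odd j i (trans (sym (+-identityʳ (2 * j))) (trans (sym eq) (+-comm (2 * i) 1))))
2*+signBit-injective {Sign.-} {Sign.-} {i} {j} eq =
  cong (Sign.- ,_) (*-cancelˡ-≡ i j 2 (+-cancelʳ-≡ 1 (2 * i) (2 * j) eq))

-- Σ₂'s palette (pairs b + t, singles h₂) is moved into ±1, …, ±(c + t) while avoiding Σ₁'s palette
-- (pairs f₁, singles h₁ = h₂ + 2b + 1, so c = f₁ + h₁): its first b pairs are broken up into
-- negative colors of absolute value f₁ + 1, …, f₁ + 2b, its singles go to the negative colors
-- of absolute value f₁ + 2b + 1, …, f₁ + 2b + h₂, and its remaining t pairs are moved beyond c.
module Placement (f₁ b t h₂ : ℕ) where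

  h₁ c : ℕ
  h₁ = h₂ + suc (2 * b)
  c = f₁ + h₁

  data Slot : ℕ → Set where
    broken : ∀ {i} → i < b → Slot i
    kept : ∀ {j} → j < t → Slot (b + j)
    single : ∀ j → Slot (b + t + j)

  slot : ∀ i → Slot i
  slot i with i <? b
  ... | yes i<b = broken i<b
  ... | no i≮b with m≤n⇒∃[o]m+o≡n (≮⇒≥ i≮b)
  ...   | j , refl with j <? t
  ...     | yes j<t = kept j<t
  ...     | no j≮t with m≤n⇒∃[o]m+o≡n (≮⇒≥ j≮t)
  ...       | j′ , refl = subst Slot (+-assoc b t j′) (single j′)

  place : Sign × ℕ → Sign × ℕ
  place (s , i) with slot i
  ... | broken {i} _ = Sign.- , f₁ + (2 * i + signBit s)
  ... | kept {j} _ = s , c + j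
  ... | single j = Sign.- , f₁ + 2 * b + j

  broken< : ∀ {i} s → i < b → f₁ + (2 * i + signBit s) < f₁ + 2 * b
  broken< {i} s i<b = +-monoʳ-< f₁ (begin-strict
    2 * i + signBit s   ≤⟨ +-monoʳ-≤ (2 * i) (signBit≤1 s) ⟩
    2 * i + 1           <⟨ n<1+n _ ⟩
    suc (2 * i + 1)     ≡⟨ regroup i ⟩
    2 * suc i           ≤⟨ *-monoʳ-≤ 2 i<b ⟩
    2 * b               ∎)
    where
    open ≤-Reasoning
    signBit≤1 : ∀ s → signBit s ≤ 1
    signBit≤1 Sign.+ = z≤n
    signBit≤1 Sign.- = s≤s z≤n
    regroup : ∀ i → suc (2 * i + 1) ≡ 2 * suc i
    regroup = solve-∀

  single< : ∀ {j} → j < h₂ → f₁ + 2 * b + j < c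
  single< {j} j<h₂ = begin-strict
    f₁ + 2 * b + j          <⟨ +-monoʳ-< (f₁ + 2 * b) j<h₂ ⟩
    f₁ + 2 * b + h₂         <⟨ n<1+n _ ⟩
    suc (f₁ + 2 * b + h₂)   ≡⟨ regroup f₁ b h₂ ⟩
    c                       ∎
    where
    open ≤-Reasoning
    regroup : ∀ f₁ b h₂ → suc (f₁ + 2 * b + h₂) ≡ f₁ + (h₂ + suc (2 * b))
    regroup = solve-∀

  f₁+2b≤c : f₁ + 2 * b ≤ c
  f₁+2b≤c = +-monoʳ-≤ f₁ (≤-trans (n≤1+n (2 * b)) (m≤n+m _ h₂))

  single-inPalette : ∀ {s j} → InPalette (b + t) h₂ (s , b + t + j) → s ≡ Sign.+ × j < h₂
  single-inPalette {j = j} (inj₁ b+t+j<b+t) = ⊥-elim (m+n≮m (b + t) j b+t+j<b+t)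
  single-inPalette {j = j} (inj₂ (s≡+ , b+t+j<b+t+h₂)) = s≡+ , +-cancelˡ-< (b + t) j _ b+t+j<b+t+h₂

  place-separating : Separating (InPalette (b + t) h₂) place
  place-separating {s , i} {s′ , i′} inP inP′ eq with slot i | slot i′
  ... | broken _ | broken _ = inj₁ (2*+signBit-injective (+-cancelˡ-≡ f₁ _ _ eq))
  ... | broken i<b | kept _ = ⊥-elim (<∧≤⇒≢ (broken< s i<b) (≤-trans f₁+2b≤c (m≤m+n c _)) eq)
  ... | broken i<b | single _ = ⊥-elim (<∧≤⇒≢ (broken< s i<b) (m≤m+n _ _) eq)
  ... | kept _ | broken i′<b = ⊥-elim (<∧≤⇒≢ (broken< s′ i′<b) (≤-trans f₁+2b≤c (m≤m+n c _)) (sym eq))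
  ... | kept {j} _ | kept {j′} _ with +-cancelˡ-≡ c j j′ eq
  ...   | refl with sign-dichotomy s s′
  ...     | inj₁ refl = inj₁ refl
  ...     | inj₂ refl = inj₂ (refl , refl)
  place-separating {s , i} {s′ , i′} inP inP′ eq | kept _ | single _ =
    ⊥-elim (<∧≤⇒≢ (single< (proj₂ (single-inPalette inP′))) (m≤m+n c _) (sym eq))
  place-separating {s , i} {s′ , i′} inP inP′ eq | single _ | broken i′<b =
    ⊥-elim (<∧≤⇒≢ (broken< s′ i′<b) (m≤m+n _ _) (sym eq))
  place-separating {s , i} {s′ , i′} inP inP′ eq | single _ | kept _ =
    ⊥-elim (<∧≤⇒≢ (single< (proj₂ (single-inPalette inP))) (m≤m+n c _) eq)
  place-separating {s , i} {s′ , i′} inP inP′ eq | single j | single j′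
    with +-cancelˡ-≡ (f₁ + 2 * b) j j′ eq
  ... | refl =
    inj₁ (cong (_, b + t + j) (trans (proj₁ (single-inPalette inP)) (sym (proj₁ (single-inPalette inP′)))))

  negative-beyond : ∀ {p y} → f₁ ≤ y → InPalette f₁ h₁ p → p ≢ (Sign.- , y)
  negative-beyond f₁≤y (inj₁ i<f₁) refl = <⇒≱ i<f₁ f₁≤y
  negative-beyond f₁≤y (inj₂ (() , _)) refl

  beyond : ∀ {p s y} → c ≤ y → InPalette f₁ h₁ p → p ≢ (s , y)
  beyond {p} c≤y inP refl = <⇒≱ (inPalette⇒< p inP) c≤y

  place-avoids : ∀ {p q} → InPalette f₁ h₁ p → InPalette (b + t) h₂ q → p ≢ place q
  place-avoids {s , i} {s′ , i′} inP inP′ with slot i′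
  ... | broken _ = negative-beyond (m≤m+n f₁ _) inP
  ... | kept _ = beyond (m≤m+n c _) inP
  ... | single j = negative-beyond (≤-trans (m≤m+n f₁ (2 * b)) (m≤m+n _ j)) inP

  place-bound : ∀ {q} → InPalette (b + t) h₂ q → proj₂ (place q) < c + t
  place-bound {s , i} inP with slot i
  ... | broken i<b = <-≤-trans (broken< s i<b) (≤-trans f₁+2b≤c (m≤m+n c t))
  ... | kept j<t = +-monoʳ-< c j<t
  ... | single _ = <-≤-trans (single< (proj₂ (single-inPalette inP))) (m≤m+n c t)

join-upperBound : ∀ Σ₁ Σ₂ {χ₁ χ₂ M₁ M₂ b t} (nf₁ : NormalForm Σ₁ χ₁ M₁) (nf₂ : NormalForm Σ₂ χ₂ M₂) →
                  singles nf₁ ≡ singles nf₂ + suc (2 * b) → b + t ≡ pairs nf₂ →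
                  Colorable (Σ₁ ∨₊ Σ₂) (2 * (pairs nf₁ + singles nf₁ + t))
join-upperBound Σ₁ Σ₂ {b = b} {t}
  record { pairs = f₁ ; coloring = c₁ ; proper = proper₁ ; inPalette = inPalette₁ }
  record { singles = h₂ ; coloring = c₂ ; proper = proper₂ ; inPalette = inPalette₂ } refl refl =
  joinColoring Σ₁ Σ₂ (⟦_⟧ ∘ c₁) (⟦_⟧ ∘ place ∘ c₂)
  , join-proper Σ₁ Σ₂ proper₁ (separating⇒proper Σ₂ c₂ proper₂ inPalette₂ place-separating) apart
  , join-inSet Σ₁ Σ₂ (inSet-even Σ₁ c₁ λ v → <-≤-trans (inPalette⇒< (c₁ v) (inPalette₁ v)) (m≤m+n _ t))
                     (inSet-even Σ₂ (place ∘ c₂) λ v → place-bound (inPalette₂ v))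
  where
  open Placement f₁ b t h₂
  apart : ∀ i j → ⟦ c₁ i ⟧ ≢ ⟦ place (c₂ j) ⟧
  apart i j eq = place-avoids (inPalette₁ i) (inPalette₂ j) (⟦⟧-injective eq)

join-chromatic : ∀ Σ₁ Σ₂ {χ₁ χ₂ M₁ M₂ b} → Exceptional Σ₁ χ₁ M₁ → Exceptional Σ₂ χ₂ M₂ →
                 (nf₁ : NormalForm Σ₁ χ₁ M₁) (nf₂ : NormalForm Σ₂ χ₂ M₂) →
                 singles nf₁ ≡ singles nf₂ + suc (2 * b) → b ≤ pairs nf₂ →
                 IsChromatic (Σ₁ ∨₊ Σ₂) (suc (2 * pairs nf₁ + singles nf₁ + (2 * pairs nf₂ + singles nf₂)))
join-chromatic Σ₁ Σ₂ {b = b} exc₁ exc₂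
  nf₁@record { pairs = f₁ ; singles = h₁ ; χ≡ = refl ; M≡ = refl }
  nf₂@record { singles = h₂ ; χ≡ = refl ; M≡ = refl } refl b≤f₂
  with t , refl ← m≤n⇒∃[o]m+o≡n b≤f₂ =
    subst (Colorable (Σ₁ ∨₊ Σ₂)) (sym (regroup-even f₁ h₂ b t)) (join-upperBound Σ₁ Σ₂ nf₁ nf₂ refl refl)
  , λ m → join-lowerBound Σ₁ Σ₂ {s₁ = 2 * f₁ + h₁} {2 * (b + t) + h₂} {f₁ + h₂ + b + (b + t)} exc₁ exc₂
                           (s+h≡2[f+h] f₁ h₁) (s+h≡2[f+h] (b + t) h₂) (regroup-odd f₁ h₂ b t)
  where
  s+h≡2[f+h] : ∀ f h → 2 * f + h + h ≡ 2 * (f + h)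
  s+h≡2[f+h] = solve-∀
  regroup-even : ∀ f₁ h₂ b t → suc (2 * f₁ + (h₂ + suc (2 * b)) + (2 * (b + t) + h₂))
                             ≡ 2 * (f₁ + (h₂ + suc (2 * b)) + t)
  regroup-even = solve-∀
  regroup-odd : ∀ f₁ h₂ b t → 2 * f₁ + (h₂ + suc (2 * b)) + (2 * (b + t) + h₂)
                            ≡ suc (2 * (f₁ + h₂ + b + (b + t)))
  regroup-odd = solve-∀

N≡1+s : ∀ f₁ h₁ f₂ h₂ → (2 * (f₁ + h₁) + 2 * (f₂ + h₂) + 1) ∸ (h₁ + h₂) ≡ suc (2 * f₁ + h₁ + (2 * f₂ + h₂))
N≡1+s f₁ h₁ f₂ h₂ = trans (cong (_∸ (h₁ + h₂)) (regroup f₁ h₁ f₂ h₂)) (m+n∸n≡m _ (h₁ + h₂))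
  where
  regroup : ∀ f₁ h₁ f₂ h₂ → 2 * (f₁ + h₁) + 2 * (f₂ + h₂) + 1 ≡ suc (2 * f₁ + h₁ + (2 * f₂ + h₂)) + (h₁ + h₂)
  regroup = solve-∀

-- both sides are 2f₁ + 2h₂ + 2b + 2 plus 2b and 2f₂ respectively
gap≤pairs : ∀ f₁ f₂ h₂ b → 2 * (f₁ + (h₂ + suc (2 * b))) ≤ suc (2 * f₁ + (h₂ + suc (2 * b)) + (2 * f₂ + h₂)) →
            b ≤ f₂
gap≤pairs f₁ f₂ h₂ b le = *-cancelˡ-≤ 2 (+-cancelˡ-≤ base _ _ (subst₂ _≤_ (lhs f₁ h₂ b) (rhs f₁ f₂ h₂ b) le))
  where
  base : ℕ
  base = 2 * f₁ + 2 * h₂ + 2 * b + 2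
  lhs : ∀ f₁ h₂ b → 2 * (f₁ + (h₂ + suc (2 * b))) ≡ 2 * f₁ + 2 * h₂ + 2 * b + 2 + 2 * b
  lhs = solve-∀
  rhs : ∀ f₁ f₂ h₂ b → suc (2 * f₁ + (h₂ + suc (2 * b)) + (2 * f₂ + h₂)) ≡ 2 * f₁ + 2 * h₂ + 2 * b + 2 + 2 * f₂
  rhs = solve-∀

lemma5 : (Σ₁ Σ₂ : SignedGraph) (χ₁ χ₂ M₁ M₂ : ℕ) →
    IsChromatic Σ₁ χ₁ → IsChromatic Σ₂ χ₂ →
    IsMaxDeficiency Σ₁ χ₁ M₁ → IsMaxDeficiency Σ₂ χ₂ M₂ →
    Even χ₁ → Even χ₂ → M₂ < M₁ →
    χ₁ ≤ (χ₁ + χ₂ + 1) ∸ (M₁ + M₂) →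
    (Odd M₁ × Even M₂) ⊎ (Even M₁ × Odd M₂) →
    Exceptional Σ₁ χ₁ M₁ → Exceptional Σ₂ χ₂ M₂ →
    IsChromatic (Σ₁ ∨₊ Σ₂) ((χ₁ + χ₂ + 1) ∸ (M₁ + M₂))
lemma5 Σ₁ Σ₂ χ₁ χ₂ M₁ M₂ chr₁ chr₂ maxDef₁ maxDef₂ even₁ even₂ M₂<M₁ χ₁≤N parity exc₁ exc₂
  with normalForm {Σ₁} {χ₁} {M₁} chr₁ even₁ maxDef₁ | normalForm {Σ₂} {χ₂} {M₂} chr₂ even₂ maxDef₂
... | nf₁@record { pairs = f₁ ; singles = h₁ ; χ≡ = refl ; M≡ = refl }
    | nf₂@record { pairs = f₂ ; singles = h₂ ; χ≡ = refl ; M≡ = refl }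
  with b , refl ← odd-difference M₂<M₁ parity =
  subst (IsChromatic (Σ₁ ∨₊ Σ₂)) (sym (N≡1+s f₁ h₁ f₂ h₂))
        (join-chromatic Σ₁ Σ₂ exc₁ exc₂ nf₁ nf₂ refl (gap≤pairs f₁ f₂ h₂ b χ₁≤1+s))
  where
  χ₁≤1+s : 2 * (f₁ + h₁) ≤ suc (2 * f₁ + h₁ + (2 * f₂ + h₂))
  χ₁≤1+s = subst (2 * (f₁ + h₁) ≤_) (N≡1+s f₁ h₁ f₂ h₂) χ₁≤N
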